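{- Let $\mathcal{J}(z)=\sum_{n\ge 0} |\mathcal{S}_n\cap Av(\mathbf{4123},\mathbf{1243},\mathbf{1423})|\, z^n$ be the generating function for the class $Av(\mathbf{4123},\mathbf{1243},\mathbf{1423})$. Then $$\mathcal{J}(z) = \frac{1+z-\sqrt{1-6z+5z^2}}{2(2z-z^2)}.$$
   Context: A permutation $\sigma$ contains a pattern $\pi$ if some subsequence of $\sigma$ is order-isomorphic to $\pi$; otherwise $\sigma$ avoids $\pi$. For a set $B$ of patterns, $Av(B)$ is the set of permutations avoiding every element of $B$, and $\mathcal{S}_n$ is the set of permutations of length $n$ (the empty permutation is counted for $n=0$). -}

module Defs where

open import Data.Nat using (ℕ; zero; suc; _<_)
open import Data.Integer using (ℤ; +_; _+_; _*_; -_; _-_)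
open import Data.Fin using (Fin) renaming (_<_ to _<ᶠ_)
open import Data.Fin.Patterns using (0F; 1F; 2F; 3F)
open import Data.Vec using (Vec; lookup; []; _∷_)
open import Data.List using (List; length; map; upTo; foldr)
open import Data.List.Relation.Unary.Unique.Propositional using (Unique)
open import Data.List.Membership.Propositional using (_∈_)
open import Data.Product using (Σ; _×_; ∃)
open import Relation.Binary.PropositionalEquality using (_≡_)
open import Relation.Nullary using (¬_)
open import Function.Bundles using (_⇔_)

-- A permutation of length n is a word σ(0) … σ(n-1) over Fin n that is
-- injective (hence bijective).  For n = 0 there is exactly the empty one.
IsPerm : {n : ℕ} → Vec (Fin n) n → Set
IsPerm {n} σ = ∀ (i j : Fin n) → lookup σ i ≡ lookup σ j → i ≡ j

Contains : {n k : ℕ} → Vec (Fin n) n → Vec (Fin k) k → Set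
Contains {n} {k} σ π =
  Σ (Fin k → Fin n) λ f →
    (∀ (i j : Fin k) → i <ᶠ j → f i <ᶠ f j) ×
    (∀ (i j : Fin k) → (lookup π i <ᶠ lookup π j) ⇔ (lookup σ (f i) <ᶠ lookup σ (f j)))

Avoids : {n k : ℕ} → Vec (Fin n) n → Vec (Fin k) k → Set
Avoids σ π = ¬ Contains σ π

-- the patterns 4123, 1243, 1423 (values shifted to start at 0)
p4123 p1243 p1423 : Vec (Fin 4) 4
p4123 = 3F ∷ 0F ∷ 1F ∷ 2F ∷ []
p1243 = 0F ∷ 1F ∷ 3F ∷ 2F ∷ []
p1423 = 0F ∷ 3F ∷ 1F ∷ 2F ∷ []

InClass : {n : ℕ} → Vec (Fin n) n → Set
InClass σ = IsPerm σ × Avoids σ p4123 × Avoids σ p1243 × Avoids σ p1423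

HasCard : (n : ℕ) → (Vec (Fin n) n → Set) → ℕ → Set
HasCard n P k =
  Σ (List (Vec (Fin n) n)) λ L →
    Unique L × (∀ σ → (σ ∈ L) ⇔ P σ) × length L ≡ k

-- Formal power series with integer coefficients, as coefficient sequences

Series : Set
Series = ℕ → ℤ

sumℤ : List ℤ → ℤ
sumℤ = foldr _+_ (+ 0)

_⋆_ : Series → Series → Series
(f ⋆ g) n = sumℤ (map (λ i → f i * g (n Data.Nat.∸ i)) (upTo (suc n)))

poly : List ℤ → Series
poly List.[] _ = + 0
poly (c List.∷ cs) zero = c
poly (c List.∷ cs) (suc n) = poly cs n

_⊕_ : Series → Series → Series
(f ⊕ g) n = f n + g n

⊖_ : Series → Series
(⊖ f) n = - f n

radicand : Series
radicand = poly (+ 1 List.∷ - + 6 List.∷ + 5 List.∷ List.[])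

IsSqrtRadicand : Series → Set
IsSqrtRadicand S = S 0 ≡ + 1 × (∀ n → (S ⋆ S) n ≡ radicand n)

-- denominator 2(2z - z²) = 4z - 2z²
denom : Series
denom = poly (+ 0 List.∷ + 4 List.∷ - + 2 List.∷ List.[])

numer : Series → Series
numer S = poly (+ 1 List.∷ + 1 List.∷ List.[]) ⊕ (⊖ S)

toSeries : (ℕ → ℕ) → Series
toSeries J n = + J n

{-# OPTIONS --safe #-}
-- The three patterns are 123 with a larger entry inserted anywhere except at the end, so the class consists
-- of the permutations in which the top of every 123 is a left-to-right maximum.  Appending a last value c to
-- such a permutation of length n stays in the class iff c is the new maximum or the values below c occur in
-- decreasing order.  Labelling a permutation by the largest k such that its k smallest values occur in
-- decreasing order gives the generating tree
--   (k) → (1), …, (k), (k + 1), (k),    with decreasing permutations    (n)↓ → (n + 1)↓, (1), …, (n).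
-- Let Tₖ and Dₙ be the generating functions of the subtrees below (k) and (n)↓.  Differencing the recurrence
-- of Tₖ shows that Tₖ = r^(k+1) / (1 - z) with r + z = 1 + z (r² + r), and the recurrence of Dₙ then gives
-- Dₙ₊₁ = r Dₙ and J = D₀ = 1 + z r J.  Eliminating r yields (2z - z²) J² + 1 = (1 + z) J, so that
-- (1 + z - 2 (2z - z²) J)² is the radicand; the sign of the root is fixed by its constant term.
module Submission where

open import Defs
open import Data.Nat using (ℕ)
open import Relation.Binary.PropositionalEquality using (_≡_)

open import Algebra.Bundles using (CommutativeRing)
import Algebra.Properties.AbelianGroup as AbelianGroupProperties
import Algebra.Solver.Ring as RingSolver
open import Algebra.Solver.Ring.AlmostCommutativeRing
  using (fromCommutativeRing; _-Raw-AlmostCommutative⟶_)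
open import Data.Fin as Fin
  using (Fin; zero; suc; toℕ; fromℕ; inject₁; inject≤; fromℕ<; punchIn; punchOut)
  renaming (_<_ to _<ᶠ_)
open import Data.Fin.Patterns using (0F; 1F; 2F; 3F)
import Data.Fin.Properties as Fin
open import Data.Fin.Relation.Unary.Top using (view; ‵fromℕ; ‵inject₁)
open import Data.Integer as ℤ using (ℤ; +_; _+_; _*_; -_)
import Data.Integer.Properties as ℤ
open import Data.Integer.Tactic.RingSolver using (solve-∀)
open import Data.List as List using (List; []; _∷_; map; concatMap; tabulate; upTo; applyUpTo; length)
import Data.List.Properties as Listₚ
open import Data.List.Membership.Propositional using (_∈_; lose)
open import Data.List.Membership.Propositional.Properties
  using (∈-map⁺; ∈-map⁻; ∈-concatMap⁺; ∈-tabulate⁺)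
open import Data.List.Membership.Propositional.Properties.WithK using (unique∧set⇒bag)
open import Data.List.Relation.Binary.BagAndSetEquality using (∼bag⇒↭)
open import Data.List.Relation.Binary.Permutation.Propositional.Properties using (↭-length)
open import Data.List.Relation.Unary.All as All using (All)
import Data.List.Relation.Unary.All.Properties as All
open import Data.List.Relation.Unary.AllPairs as AllPairs using ([]; _∷_)
import Data.List.Relation.Unary.AllPairs.Properties as AllPairs
open import Data.List.Relation.Unary.Any using (here; there)
open import Data.List.Relation.Unary.Unique.Propositional using (Unique)
import Data.List.Relation.Unary.Unique.Propositional.Properties as Unique
open import Data.Maybe as Maybe using (Maybe)
open import Data.Nat as ℕ using (zero; suc; z≤n; s≤s)
open import Data.Nat.ListAction using (sum)
open import Data.Nat.ListAction.Properties using (sum-++)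
import Data.Nat.Properties as ℕ
import Data.Nat.Tactic.RingSolver as ℕ-Solver
open import Data.Product using (∃; _×_; _,_; proj₁; proj₂)
open import Data.Sum using (_⊎_; inj₁; inj₂; [_,_]′)
open import Data.Vec as Vec using (Vec; lookup)
import Data.Vec.Properties as Vec
open import Function using (_∘_)
open import Function.Bundles using (_⇔_; mk⇔; Equivalence)
open import Level using (0ℓ)
open import Relation.Binary.Definitions using (tri<; tri≈; tri>)
open import Relation.Binary.PropositionalEquality
  using (_≢_; _≗_; refl; sym; trans; cong; cong₂; subst; subst₂; module ≡-Reasoning)
open import Relation.Nullary using (¬_; yes; no; contradiction)
open import Relation.Nullary.Decidable using (dec⇒maybe)

open ≡-Reasoning

-- Formal power series

const : ℤ → Series
const c = poly (c ∷ [])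

z : Series
z = poly (+ 0 ∷ + 1 ∷ [])

tail : Series → Series
tail f = f ∘ suc

scale : ℤ → Series → Series
scale c f n = c * f n

⋆-suc : ∀ f g n → (f ⋆ g) (suc n) ≡ f 0 * g (suc n) + (tail f ⋆ g) n
⋆-suc f g n = cong (λ l → f 0 * g (suc n) + sumℤ l) (begin
  map (λ i → f i * g (suc n ℕ.∸ i)) (applyUpTo suc (suc n))
    ≡⟨ Listₚ.map-applyUpTo suc _ (suc n) ⟩
  applyUpTo (λ i → f (suc i) * g (n ℕ.∸ i)) (suc n)
    ≡⟨ Listₚ.map-upTo _ (suc n) ⟨
  map (λ i → f (suc i) * g (n ℕ.∸ i)) (upTo (suc n)) ∎)

⋆-zero : ∀ f g → (f ⋆ g) 0 ≡ f 0 * g 0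
⋆-zero f g = ℤ.+-identityʳ _

⋆-cong : ∀ {f f′ g g′} → f ≗ f′ → g ≗ g′ → f ⋆ g ≗ f′ ⋆ g′
⋆-cong {f} {f′} {g} {g′} p q zero = begin
  (f ⋆ g) 0     ≡⟨ ⋆-zero f g ⟩
  f 0 * g 0     ≡⟨ cong₂ _*_ (p 0) (q 0) ⟩
  f′ 0 * g′ 0   ≡⟨ ⋆-zero f′ g′ ⟨
  (f′ ⋆ g′) 0   ∎
⋆-cong {f} {f′} {g} {g′} p q (suc n) = begin
  (f ⋆ g) (suc n)                       ≡⟨ ⋆-suc f g n ⟩
  f 0 * g (suc n) + (tail f ⋆ g) n
    ≡⟨ cong₂ _+_ (cong₂ _*_ (p 0) (q (suc n))) (⋆-cong {g = g} (p ∘ suc) q n) ⟩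
  f′ 0 * g′ (suc n) + (tail f′ ⋆ g′) n  ≡⟨ ⋆-suc f′ g′ n ⟨
  (f′ ⋆ g′) (suc n)                     ∎

-- Splits off the last summand of the convolution where `⋆-suc` splits off the first. The two
-- together give commutativity by induction on the index.
⋆-sucʳ : ∀ f g n → (f ⋆ g) (suc n) ≡ f (suc n) * g 0 + (f ⋆ tail g) n
⋆-sucʳ f g zero = begin
  (f ⋆ g) 1                                    ≡⟨ ⋆-suc f g 0 ⟩
  f 0 * g 1 + (tail f ⋆ g) 0                   ≡⟨ cong (λ x → f 0 * g 1 + x) (⋆-zero (tail f) g) ⟩
  f 0 * g 1 + f 1 * g 0                        ≡⟨ ℤ.+-comm (f 0 * g 1) _ ⟩
  f 1 * g 0 + f 0 * g 1                        ≡⟨ cong (λ x → f 1 * g 0 + x) (⋆-zero f (tail g)) ⟨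
  f 1 * g 0 + (f ⋆ tail g) 0                   ∎
⋆-sucʳ f g (suc n) = begin
  (f ⋆ g) (2 ℕ.+ n)
    ≡⟨ ⋆-suc f g (suc n) ⟩
  f 0 * g (2 ℕ.+ n) + (tail f ⋆ g) (suc n)
    ≡⟨ cong (λ x → f 0 * g (2 ℕ.+ n) + x) (⋆-sucʳ (tail f) g n) ⟩
  f 0 * g (2 ℕ.+ n) + (f (2 ℕ.+ n) * g 0 + (tail f ⋆ tail g) n)
    ≡⟨ swap (f 0 * g (2 ℕ.+ n)) (f (2 ℕ.+ n) * g 0) ((tail f ⋆ tail g) n) ⟩
  f (2 ℕ.+ n) * g 0 + (f 0 * g (2 ℕ.+ n) + (tail f ⋆ tail g) n)
    ≡⟨ cong (λ x → f (2 ℕ.+ n) * g 0 + x) (⋆-suc f (tail g) n) ⟨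
  f (2 ℕ.+ n) * g 0 + (f ⋆ tail g) (suc n) ∎
  where
  swap : ∀ a b c → a + (b + c) ≡ b + (a + c)
  swap = solve-∀

⋆-comm : ∀ f g → f ⋆ g ≗ g ⋆ f
⋆-comm f g zero = begin
  (f ⋆ g) 0  ≡⟨ ⋆-zero f g ⟩
  f 0 * g 0  ≡⟨ ℤ.*-comm (f 0) (g 0) ⟩
  g 0 * f 0  ≡⟨ ⋆-zero g f ⟨
  (g ⋆ f) 0  ∎
⋆-comm f g (suc n) = begin
  (f ⋆ g) (suc n)                   ≡⟨ ⋆-suc f g n ⟩
  f 0 * g (suc n) + (tail f ⋆ g) n  ≡⟨ cong₂ _+_ (ℤ.*-comm (f 0) _) (⋆-comm (tail f) g n) ⟩
  g (suc n) * f 0 + (g ⋆ tail f) n  ≡⟨ ⋆-sucʳ g f n ⟨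
  (g ⋆ f) (suc n)                   ∎

⋆-distribʳ-⊕ : ∀ h f g → (f ⊕ g) ⋆ h ≗ (f ⋆ h) ⊕ (g ⋆ h)
⋆-distribʳ-⊕ h f g zero = begin
  ((f ⊕ g) ⋆ h) 0          ≡⟨ ⋆-zero (f ⊕ g) h ⟩
  (f 0 + g 0) * h 0        ≡⟨ ℤ.*-distribʳ-+ (h 0) (f 0) (g 0) ⟩
  f 0 * h 0 + g 0 * h 0    ≡⟨ cong₂ _+_ (⋆-zero f h) (⋆-zero g h) ⟨
  (f ⋆ h) 0 + (g ⋆ h) 0    ∎
⋆-distribʳ-⊕ h f g (suc n) = begin
  ((f ⊕ g) ⋆ h) (suc n)
    ≡⟨ ⋆-suc (f ⊕ g) h n ⟩
  (f 0 + g 0) * h (suc n) + ((tail f ⊕ tail g) ⋆ h) n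
    ≡⟨ cong (λ x → (f 0 + g 0) * h (suc n) + x) (⋆-distribʳ-⊕ h (tail f) (tail g) n) ⟩
  (f 0 + g 0) * h (suc n) + ((tail f ⋆ h) n + (tail g ⋆ h) n)
    ≡⟨ rearrange (f 0) (g 0) (h (suc n)) ((tail f ⋆ h) n) ((tail g ⋆ h) n) ⟩
  (f 0 * h (suc n) + (tail f ⋆ h) n) + (g 0 * h (suc n) + (tail g ⋆ h) n)
    ≡⟨ cong₂ _+_ (⋆-suc f h n) (⋆-suc g h n) ⟨
  (f ⋆ h) (suc n) + (g ⋆ h) (suc n) ∎
  where
  rearrange : ∀ a b c d e → (a + b) * c + (d + e) ≡ (a * c + d) + (b * c + e)
  rearrange = solve-∀

scale-⋆ : ∀ c f g → scale c f ⋆ g ≗ scale c (f ⋆ g)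
scale-⋆ c f g zero = begin
  (scale c f ⋆ g) 0  ≡⟨ ⋆-zero (scale c f) g ⟩
  c * f 0 * g 0      ≡⟨ ℤ.*-assoc c (f 0) (g 0) ⟩
  c * (f 0 * g 0)    ≡⟨ cong (c *_) (⋆-zero f g) ⟨
  c * (f ⋆ g) 0      ∎
scale-⋆ c f g (suc n) = begin
  (scale c f ⋆ g) (suc n)                             ≡⟨ ⋆-suc (scale c f) g n ⟩
  c * f 0 * g (suc n) + (scale c (tail f) ⋆ g) n      ≡⟨ cong (λ x → c * f 0 * g (suc n) + x) (scale-⋆ c (tail f) g n) ⟩
  c * f 0 * g (suc n) + c * (tail f ⋆ g) n            ≡⟨ factor c (f 0) (g (suc n)) ((tail f ⋆ g) n) ⟩
  c * (f 0 * g (suc n) + (tail f ⋆ g) n)              ≡⟨ cong (c *_) (⋆-suc f g n) ⟨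
  c * (f ⋆ g) (suc n)                                 ∎
  where
  factor : ∀ a b c d → a * b * c + a * d ≡ a * (b * c + d)
  factor = solve-∀

⋆-assoc : ∀ f g h → (f ⋆ g) ⋆ h ≗ f ⋆ (g ⋆ h)
⋆-assoc f g h zero = begin
  ((f ⋆ g) ⋆ h) 0      ≡⟨ ⋆-zero (f ⋆ g) h ⟩
  (f ⋆ g) 0 * h 0      ≡⟨ cong (_* h 0) (⋆-zero f g) ⟩
  f 0 * g 0 * h 0      ≡⟨ ℤ.*-assoc (f 0) _ _ ⟩
  f 0 * (g 0 * h 0)    ≡⟨ cong (f 0 *_) (⋆-zero g h) ⟨
  f 0 * (g ⋆ h) 0      ≡⟨ ⋆-zero f (g ⋆ h) ⟨
  (f ⋆ (g ⋆ h)) 0      ∎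
⋆-assoc f g h (suc n) = begin
  ((f ⋆ g) ⋆ h) (suc n)
    ≡⟨ ⋆-suc (f ⋆ g) h n ⟩
  (f ⋆ g) 0 * h (suc n) + (tail (f ⋆ g) ⋆ h) n
    -- As a pointwise equality, `⋆-suc f g` is a product rule for `tail (f ⋆ g)`.
    ≡⟨ cong₂ _+_ (cong (_* h (suc n)) (⋆-zero f g)) (⋆-cong {g = h} (⋆-suc f g) (λ _ → refl) n) ⟩
  f 0 * g 0 * h (suc n) + ((scale (f 0) (tail g) ⊕ (tail f ⋆ g)) ⋆ h) n
    ≡⟨ cong (λ x → f 0 * g 0 * h (suc n) + x) (⋆-distribʳ-⊕ h (scale (f 0) (tail g)) (tail f ⋆ g) n) ⟩
  f 0 * g 0 * h (suc n) + ((scale (f 0) (tail g) ⋆ h) n + ((tail f ⋆ g) ⋆ h) n)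
    ≡⟨ cong (λ x → f 0 * g 0 * h (suc n) + x) (cong₂ _+_ (scale-⋆ (f 0) (tail g) h n) (⋆-assoc (tail f) g h n)) ⟩
  f 0 * g 0 * h (suc n) + (f 0 * (tail g ⋆ h) n + (tail f ⋆ (g ⋆ h)) n)
    ≡⟨ factor (f 0) (g 0) (h (suc n)) ((tail g ⋆ h) n) ((tail f ⋆ (g ⋆ h)) n) ⟩
  f 0 * (g 0 * h (suc n) + (tail g ⋆ h) n) + (tail f ⋆ (g ⋆ h)) n
    ≡⟨ cong (λ x → f 0 * x + (tail f ⋆ (g ⋆ h)) n) (⋆-suc g h n) ⟨
  f 0 * (g ⋆ h) (suc n) + (tail f ⋆ (g ⋆ h)) n
    ≡⟨ ⋆-suc f (g ⋆ h) n ⟨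
  (f ⋆ (g ⋆ h)) (suc n) ∎
  where
  factor : ∀ a b c d e → a * b * c + (a * d + e) ≡ a * (b * c + d) + e
  factor = solve-∀

⋆-zeroˡ : ∀ f → (λ _ → + 0) ⋆ f ≗ λ _ → + 0
⋆-zeroˡ f zero    = ⋆-zero (λ _ → + 0) f
⋆-zeroˡ f (suc n) = trans (⋆-suc (λ _ → + 0) f n) (trans (ℤ.+-identityˡ (((λ _ → + 0) ⋆ f) n)) (⋆-zeroˡ f n))

const-⋆ : ∀ c f → const c ⋆ f ≗ scale c f
const-⋆ c f zero    = ⋆-zero (const c) f
const-⋆ c f (suc n) = begin
  (const c ⋆ f) (suc n)                      ≡⟨ ⋆-suc (const c) f n ⟩
  c * f (suc n) + ((λ _ → + 0) ⋆ f) n        ≡⟨ cong (λ x → c * f (suc n) + x) (⋆-zeroˡ f n) ⟩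
  c * f (suc n) + + 0                        ≡⟨ ℤ.+-identityʳ _ ⟩
  c * f (suc n)                              ∎

-- The ring of formal power series and its solver

seriesRing : CommutativeRing 0ℓ 0ℓ
seriesRing = record
  { Carrier = Series
  ; _≈_ = _≗_
  ; _+_ = _⊕_
  ; _*_ = _⋆_
  ; -_  = ⊖_
  -- With this zero, rather than the constantly zero sequence, `const` preserves zero
  -- definitionally.
  ; 0#  = const (+ 0)
  ; 1#  = const (+ 1)
  ; isCommutativeRing = record
    { isRing = record
      { +-isAbelianGroup = record
        { isGroup = record
          { isMonoid = record
            { isSemigroup = record
              { isMagma = record
                { isEquivalence = record
                  { refl = λ _ → refl
                  ; sym = λ p n → sym (p n)
                  ; trans = λ p q n → trans (p n) (q n)
                  }
                ; ∙-cong = λ p q n → cong₂ _+_ (p n) (q n)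
                }
              ; assoc = λ f g h n → ℤ.+-assoc (f n) (g n) (h n)
              }
            ; identity = ⊕-identityˡ , λ f n → trans (ℤ.+-comm (f n) _) (⊕-identityˡ f n)
            }
          ; inverse = ⊖-inverseˡ , λ f n → trans (ℤ.+-comm (f n) _) (⊖-inverseˡ f n)
          ; ⁻¹-cong = λ p n → cong -_ (p n)
          }
        ; comm = λ f g n → ℤ.+-comm (f n) (g n)
        }
      ; *-cong = ⋆-cong
      ; *-assoc = ⋆-assoc
      ; *-identity = ⋆-identityˡ , λ f n → trans (⋆-comm f (const (+ 1)) n) (⋆-identityˡ f n)
      ; distrib = (λ h f g n → trans (⋆-comm h (f ⊕ g) n) (trans (⋆-distribʳ-⊕ h f g n)
                    (cong₂ _+_ (⋆-comm f h n) (⋆-comm g h n))))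
                , ⋆-distribʳ-⊕
      }
    ; *-comm = ⋆-comm
    }
  }
  where
  const0 : const (+ 0) ≗ λ _ → + 0
  const0 zero    = refl
  const0 (suc _) = refl
  ⊕-identityˡ : ∀ f → const (+ 0) ⊕ f ≗ f
  ⊕-identityˡ f n = trans (cong (_+ f n) (const0 n)) (ℤ.+-identityˡ (f n))
  ⊖-inverseˡ : ∀ f → (⊖ f) ⊕ f ≗ const (+ 0)
  ⊖-inverseˡ f n = trans (ℤ.+-inverseˡ (f n)) (sym (const0 n))
  ⋆-identityˡ : ∀ f → const (+ 1) ⋆ f ≗ f
  ⋆-identityˡ f n = trans (const-⋆ (+ 1) f n) (ℤ.*-identityˡ (f n))

module 𝕊 = CommutativeRing seriesRing

const-homo : CommutativeRing.rawRing ℤ.+-*-commutativeRing -Raw-AlmostCommutative⟶ fromCommutativeRing seriesRing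
const-homo = record
  { ⟦_⟧    = const
  ; +-homo = λ { a b zero → refl ; a b (suc n) → refl }
  ; *-homo = λ a b n → trans (lemma a b n) (sym (const-⋆ a (const b) n))
  ; -‿homo = λ { a zero → refl ; a (suc n) → refl }
  ; 0-homo = λ _ → refl
  ; 1-homo = λ _ → refl
  }
  where
  lemma : ∀ a b → const (a * b) ≗ scale a (const b)
  lemma a b zero    = refl
  lemma a b (suc n) = sym (ℤ.*-zeroʳ a)

const-≟ : ∀ a b → Maybe (const a ≗ const b)
const-≟ a b = Maybe.map (λ a≡b n → cong (λ c → const c n) a≡b) (dec⇒maybe (a ℤ.≟ b))

module Solver = RingSolver
  (CommutativeRing.rawRing ℤ.+-*-commutativeRing) (fromCommutativeRing seriesRing) const-homo const-≟
open Solver using (solve; con; _:+_; _:*_; :-_; _:-_; _:=_)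

-- Every derivation of an equation from another one is reduced to a ring identity by adding a multiple.
by-multiple : ∀ {l r} → l ≗ r → ∀ c {a b} → a ⊕ (c ⋆ r) ≗ b ⊕ (c ⋆ l) → a ≗ b
by-multiple {l} {r} l≗r c {a} {b} eq = ∙-cancelʳ (c ⋆ r) a b
  (λ n → trans (eq n) (cong (λ x → b n + x) (⋆-cong {f = c} (λ _ → refl) l≗r n)))
  where open AbelianGroupProperties 𝕊.+-abelianGroup

z-⋆-suc : ∀ f n → (z ⋆ f) (suc n) ≡ f n
z-⋆-suc f n = begin
  (z ⋆ f) (suc n)             ≡⟨ ⋆-suc z f n ⟩
  + 0 + (tail z ⋆ f) n        ≡⟨ ℤ.+-identityˡ _ ⟩
  (const (+ 1) ⋆ f) n         ≡⟨ 𝕊.*-identityˡ f n ⟩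
  f n                         ∎

-- Since ℤ has no zero divisors, the constant term of `g` vanishes; then `f` also annihilates
-- `tail g`, and induction on the index applies.
f⋆g≗0⇒g≗0 : ∀ f → f 0 ≢ + 0 → ∀ g → f ⋆ g ≗ const (+ 0) → g ≗ const (+ 0)
f⋆g≗0⇒g≗0 f f0≢0 g fg≗0 = go
  where
  g0≡0 : g 0 ≡ + 0
  g0≡0 = [ (λ f0≡0 → contradiction f0≡0 f0≢0) , (λ g0≡0 → g0≡0) ]′
    (ℤ.i*j≡0⇒i≡0∨j≡0 (f 0) (trans (sym (⋆-zero f g)) (fg≗0 0)))
  f⋆tailg≗0 : f ⋆ tail g ≗ const (+ 0)
  f⋆tailg≗0 n = begin
    (f ⋆ tail g) n                       ≡⟨ ℤ.+-identityˡ _ ⟨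
    + 0 + (f ⋆ tail g) n                 ≡⟨ cong (_+ (f ⋆ tail g) n) (ℤ.*-zeroʳ (f (suc n))) ⟨
    f (suc n) * + 0 + (f ⋆ tail g) n     ≡⟨ cong (λ x → f (suc n) * x + (f ⋆ tail g) n) g0≡0 ⟨
    f (suc n) * g 0 + (f ⋆ tail g) n     ≡⟨ ⋆-sucʳ f g n ⟨
    (f ⋆ g) (suc n)                      ≡⟨ fg≗0 (suc n) ⟩
    -- The left identity law at the constantly zero series shows, without a case split on `n`, that
    -- `const (+ 0)` has only zero coefficients.
    + 0                                  ≡⟨ 𝕊.+-identityˡ (λ _ → + 0) n ⟨
    const (+ 0) n + + 0                  ≡⟨ ℤ.+-identityʳ _ ⟩
    const (+ 0) n                        ∎
  go : g ≗ const (+ 0)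
  go zero    = g0≡0
  go (suc n) = trans (f⋆g≗0⇒g≗0 f f0≢0 (tail g) f⋆tailg≗0 n)
    (trans (sym (ℤ.+-identityʳ _)) (𝕊.+-identityˡ (λ _ → + 0) n))

-- Generating functions of the tree

-- T m k and D m n count the descendants m generations below a node labelled non k, resp. decr of length n.
T D : ℕ → ℕ → ℕ
T zero    k = 1
T (suc m) k = T m k ℕ.+ (T m (suc k) ℕ.+ sum (applyUpTo (λ j → T m (suc j)) k))
D zero    n = 1
D (suc m) n = D m (suc n) ℕ.+ sum (applyUpTo (λ j → T m (suc j)) n)

sum-applyUpTo-suc : ∀ f k → sum (applyUpTo f (suc k)) ≡ sum (applyUpTo f k) ℕ.+ f k
sum-applyUpTo-suc f k = begin
  sum (applyUpTo f (suc k))          ≡⟨ cong sum (Listₚ.applyUpTo-∷ʳ f k) ⟨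
  sum (applyUpTo f k List.∷ʳ f k)        ≡⟨ sum-++ (applyUpTo f k) _ ⟩
  sum (applyUpTo f k) ℕ.+ (f k ℕ.+ 0)  ≡⟨ cong (sum (applyUpTo f k) ℕ.+_) (ℕ.+-identityʳ (f k)) ⟩
  sum (applyUpTo f k) ℕ.+ f k        ∎

-- Index 0, with generating function 1/(1 - z), extends the differenced recurrence of T one step to the left.
Q : ℕ → ℕ → ℕ
Q zero    m = 1
Q (suc k) m = T m k

-- Subtracting the recurrences of `T` at consecutive labels cancels all but one term of the sum.
-- Negative terms are moved across to stay in ℕ.
Q-rec : ∀ k m → Q (suc k) (suc m) ℕ.+ Q k m ≡ Q k (suc m) ℕ.+ (Q (2 ℕ.+ k) m ℕ.+ Q (1 ℕ.+ k) m)
Q-rec zero    m = lemma (T m 0) (T m 1)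
  where
  lemma : ∀ a b → (a ℕ.+ (b ℕ.+ 0)) ℕ.+ 1 ≡ 1 ℕ.+ (b ℕ.+ a)
  lemma = ℕ-Solver.solve-∀
Q-rec (suc k) m = trans
  (cong (λ s → T m (suc k) ℕ.+ (T m (2 ℕ.+ k) ℕ.+ s) ℕ.+ T m k) (sum-applyUpTo-suc (λ j → T m (suc j)) k))
  (lemma (T m k) (T m (suc k)) (T m (2 ℕ.+ k)) (sum (applyUpTo (λ j → T m (suc j)) k)))
  where
  lemma : ∀ a b c s → b ℕ.+ (c ℕ.+ (s ℕ.+ b)) ℕ.+ a ≡ a ℕ.+ (b ℕ.+ s) ℕ.+ (c ℕ.+ b)
  lemma = ℕ-Solver.solve-∀

-- `D (suc m) n` and `T (suc m) n` contain the same sum, which cancels.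
D-rec : ∀ n m → D (suc m) n ℕ.+ (Q (1 ℕ.+ n) m ℕ.+ Q (2 ℕ.+ n) m) ≡ D m (suc n) ℕ.+ Q (1 ℕ.+ n) (suc m)
D-rec n m = lemma (D m (suc n)) (sum (applyUpTo (λ j → T m (suc j)) n)) (T m n) (T m (suc n))
  where
  lemma : ∀ d s a b → d ℕ.+ s ℕ.+ (a ℕ.+ b) ≡ d ℕ.+ (a ℕ.+ (b ℕ.+ s))
  lemma = ℕ-Solver.solve-∀

-- Geometric progressions and the quadratic equation

𝒬 𝒟 : ℕ → Series
𝒬 k = toSeries (Q k)
𝒟 n = toSeries (λ m → D m n)

Q-Recurrence : (ℕ → Series) → Set
Q-Recurrence X = ∀ k → X (suc k) ⊕ (z ⋆ X k) ≗ X k ⊕ (z ⋆ (X (2 ℕ.+ k) ⊕ X (1 ℕ.+ k)))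

-- The recurrence looks second order in `k`, but `X (2 + k)` carries a factor `z`: a coefficient of
-- `X (suc k)` depends on the same coefficient of `X k` and on earlier coefficients. Hence the
-- induction is on `m` first and then on `k`, and `X 0` determines everything.
Q-Recurrence-unique : ∀ X Y → Q-Recurrence X → Q-Recurrence Y → X 0 ≗ Y 0 → ∀ k → X k ≗ Y k
Q-Recurrence-unique X Y recX recY X₀≗Y₀ k m = go m k
  where
  open AbelianGroupProperties ℤ.+-0-abelianGroup
  go : ∀ m k → X k m ≡ Y k m
  go m       zero    = X₀≗Y₀ m
  go zero    (suc k) = begin
    X (suc k) 0        ≡⟨ ℤ.+-identityʳ _ ⟨
    X (suc k) 0 + + 0  ≡⟨ recX k 0 ⟩
    X k 0 + + 0        ≡⟨ cong (_+ + 0) (go 0 k) ⟩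
    Y k 0 + + 0        ≡⟨ recY k 0 ⟨
    Y (suc k) 0 + + 0  ≡⟨ ℤ.+-identityʳ _ ⟩
    Y (suc k) 0        ∎
  go (suc m) (suc k) = ∙-cancelʳ (X k m) (X (suc k) (suc m)) (Y (suc k) (suc m)) (begin
    X (suc k) (suc m) + X k m
      ≡⟨ cong (λ x → X (suc k) (suc m) + x) (z-⋆-suc (X k) m) ⟨
    X (suc k) (suc m) + (z ⋆ X k) (suc m)
      ≡⟨ recX k (suc m) ⟩
    X k (suc m) + (z ⋆ (X (2 ℕ.+ k) ⊕ X (1 ℕ.+ k))) (suc m)
      ≡⟨ cong (λ x → X k (suc m) + x) (z-⋆-suc (X (2 ℕ.+ k) ⊕ X (1 ℕ.+ k)) m) ⟩
    X k (suc m) + (X (2 ℕ.+ k) m + X (1 ℕ.+ k) m)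
      ≡⟨ cong₂ _+_ (go (suc m) k) (cong₂ _+_ (go m (2 ℕ.+ k)) (go m (1 ℕ.+ k))) ⟩
    Y k (suc m) + (Y (2 ℕ.+ k) m + Y (1 ℕ.+ k) m)
      ≡⟨ cong (λ x → Y k (suc m) + x) (z-⋆-suc (Y (2 ℕ.+ k) ⊕ Y (1 ℕ.+ k)) m) ⟨
    Y k (suc m) + (z ⋆ (Y (2 ℕ.+ k) ⊕ Y (1 ℕ.+ k))) (suc m)
      ≡⟨ recY k (suc m) ⟨
    Y (suc k) (suc m) + (z ⋆ Y k) (suc m)
      ≡⟨ cong (λ x → Y (suc k) (suc m) + x) (z-⋆-suc (Y k) m) ⟩
    Y (suc k) (suc m) + Y k m
      ≡⟨ cong (λ x → Y (suc k) (suc m) + x) (go m k) ⟨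
    Y (suc k) (suc m) + X k m ∎)

𝒬-rec : Q-Recurrence 𝒬
𝒬-rec zero    zero    = refl
𝒬-rec (suc k) zero    = refl
𝒬-rec k       (suc m) = begin
  𝒬 (suc k) (suc m) + (z ⋆ 𝒬 k) (suc m)
    ≡⟨ cong (λ x → 𝒬 (suc k) (suc m) + x) (z-⋆-suc (𝒬 k) m) ⟩
  + (Q (suc k) (suc m) ℕ.+ Q k m)
    ≡⟨ cong +_ (Q-rec k m) ⟩
  𝒬 k (suc m) + (𝒬 (2 ℕ.+ k) ⊕ 𝒬 (1 ℕ.+ k)) m
    ≡⟨ cong (λ x → 𝒬 k (suc m) + x) (z-⋆-suc (𝒬 (2 ℕ.+ k) ⊕ 𝒬 (1 ℕ.+ k)) m) ⟨
  𝒬 k (suc m) + (z ⋆ (𝒬 (2 ℕ.+ k) ⊕ 𝒬 (1 ℕ.+ k))) (suc m) ∎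

𝒬₀-geometric : 𝒬 0 ≗ const (+ 1) ⊕ (z ⋆ 𝒬 0)
𝒬₀-geometric zero    = refl
𝒬₀-geometric (suc m) = sym (trans (ℤ.+-identityˡ _) (z-⋆-suc (𝒬 0) m))

-- The ratio of the geometric progression Q k = r ^ k / (1 - z).
r : Series
r = (const (+ 1) ⊕ (⊖ z)) ⋆ 𝒬 1

r⋆-rec : ∀ X → Q-Recurrence X → Q-Recurrence (λ k → r ⋆ X k)
r⋆-rec X rec k = by-multiple (rec k) r
  (solve 5 (λ z r a b c →
      (r :* b :+ z :* (r :* a)) :+ r :* (a :+ z :* (c :+ b))
        := (r :* a :+ z :* (r :* c :+ r :* b)) :+ r :* (b :+ z :* a))
    𝕊.refl z r (X k) (X (suc k)) (X (2 ℕ.+ k)))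

-- The coefficients of the recurrence do not depend on `k`, so both multiplying by `r` and shifting
-- `k` preserve it; only `k = 0` is left to compare.
r⋆𝒬 : ∀ k → r ⋆ 𝒬 k ≗ 𝒬 (suc k)
r⋆𝒬 = Q-Recurrence-unique (λ k → r ⋆ 𝒬 k) (λ k → 𝒬 (suc k)) (r⋆-rec 𝒬 𝒬-rec) (λ k → 𝒬-rec (suc k))
  -- The case `k = 0`: `r ⋆ 𝒬 0` is `𝒬 1` times `(1 - z) 𝒬 0`, which is 1.
  (by-multiple 𝒬₀-geometric (𝒬 1)
    (solve 3 (λ z a b →
        (con (+ 1) :- z) :* b :* a :+ b :* (con (+ 1) :+ z :* a) := b :+ b :* a)
      𝕊.refl z (𝒬 0) (𝒬 1)))

D-Recurrence : (ℕ → Series) → (ℕ → Series) → Set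
D-Recurrence Y X = ∀ n → X n ⊕ (z ⋆ (Y (1 ℕ.+ n) ⊕ Y (2 ℕ.+ n))) ≗ (z ⋆ X (suc n)) ⊕ Y (1 ℕ.+ n)

-- Each coefficient of `X n` is fixed by the preceding coefficient of `X (suc n)`, so the induction
-- is on `m` for all `n` at once, and even `X 0` is determined.
D-Recurrence-unique : ∀ Y X X′ → D-Recurrence Y X → D-Recurrence Y X′ → ∀ n → X n ≗ X′ n
D-Recurrence-unique Y X X′ rec rec′ n m = go m n
  where
  open AbelianGroupProperties ℤ.+-0-abelianGroup
  y : ℕ → Series
  y n = z ⋆ (Y (1 ℕ.+ n) ⊕ Y (2 ℕ.+ n))
  go : ∀ m n → X n m ≡ X′ n m
  -- At index 0 the products with `z` compute to zero, so the two right-hand sides agree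
  -- definitionally.
  go zero    n = ∙-cancelʳ (y n 0) (X n 0) (X′ n 0) (trans (rec n 0) (sym (rec′ n 0)))
  go (suc m) n = ∙-cancelʳ (y n (suc m)) (X n (suc m)) (X′ n (suc m)) (begin
    X n (suc m) + y n (suc m)
      ≡⟨ rec n (suc m) ⟩
    (z ⋆ X (suc n)) (suc m) + Y (1 ℕ.+ n) (suc m)
      ≡⟨ cong (_+ Y (1 ℕ.+ n) (suc m)) (begin
           (z ⋆ X (suc n)) (suc m)   ≡⟨ z-⋆-suc (X (suc n)) m ⟩
           X (suc n) m               ≡⟨ go m (suc n) ⟩
           X′ (suc n) m              ≡⟨ z-⋆-suc (X′ (suc n)) m ⟨
           (z ⋆ X′ (suc n)) (suc m)  ∎) ⟩
    (z ⋆ X′ (suc n)) (suc m) + Y (1 ℕ.+ n) (suc m)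
      ≡⟨ rec′ n (suc m) ⟨
    X′ n (suc m) + y n (suc m) ∎)

𝒟-rec : D-Recurrence 𝒬 𝒟
𝒟-rec n zero    = refl
𝒟-rec n (suc m) = begin
  𝒟 n (suc m) + (z ⋆ (𝒬 (1 ℕ.+ n) ⊕ 𝒬 (2 ℕ.+ n))) (suc m)
    ≡⟨ cong (λ x → 𝒟 n (suc m) + x) (z-⋆-suc (𝒬 (1 ℕ.+ n) ⊕ 𝒬 (2 ℕ.+ n)) m) ⟩
  + (D (suc m) n ℕ.+ (Q (1 ℕ.+ n) m ℕ.+ Q (2 ℕ.+ n) m))
    ≡⟨ cong +_ (D-rec n m) ⟩
  𝒟 (suc n) m + 𝒬 (1 ℕ.+ n) (suc m)
    ≡⟨ cong (_+ 𝒬 (1 ℕ.+ n) (suc m)) (z-⋆-suc (𝒟 (suc n)) m) ⟨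
  (z ⋆ 𝒟 (suc n)) (suc m) + 𝒬 (1 ℕ.+ n) (suc m) ∎

-- Multiplying `𝒟-rec` by `r` shifts each `𝒬` by one, by `r⋆𝒬`, so `r ⋆ 𝒟 n` satisfies the
-- recurrence of `𝒟 (suc n)`. The multiples `1 - z` and `- z` are the coefficients of the two `𝒬`
-- terms.
r⋆𝒟 : ∀ n → r ⋆ 𝒟 n ≗ 𝒟 (suc n)
r⋆𝒟 = D-Recurrence-unique (λ k → 𝒬 (suc k)) (λ n → r ⋆ 𝒟 n) (λ n → 𝒟 (suc n))
  (λ n → by-multiple (𝒟-rec n) r (by-multiple (r⋆𝒬 (1 ℕ.+ n)) (const (+ 1) ⊕ (⊖ z))
    (by-multiple (r⋆𝒬 (2 ℕ.+ n)) (⊖ z)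
      (solve 7 (λ z r d₀ d₁ q₁ q₂ q₃ →
          r :* d₀ :+ z :* (q₂ :+ q₃) :+ r :* (z :* d₁ :+ q₁) :+ (con (+ 1) :- z) :* q₂ :+ (:- z) :* q₃
            := z :* (r :* d₁) :+ q₂ :+ r :* (d₀ :+ z :* (q₁ :+ q₂)) 
               :+ (con (+ 1) :- z) :* (r :* q₁) :+ (:- z) :* (r :* q₂))
        𝕊.refl z r (𝒟 n) (𝒟 (suc n)) (𝒬 (1 ℕ.+ n)) (𝒬 (2 ℕ.+ n)) (𝒬 (3 ℕ.+ n))))))
  (λ n → 𝒟-rec (suc n))

-- At `n = 0` the `𝒬` terms of `𝒟-rec` add up to `(1 - z) 𝒬 0 = 1` by `𝒬-rec 0`, and `𝒟 1` is
-- `r ⋆ 𝒟 0`.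
𝒟₀-linear : 𝒟 0 ≗ const (+ 1) ⊕ (z ⋆ (r ⋆ 𝒟 0))
𝒟₀-linear = by-multiple (𝒟-rec 0) (const (+ 1)) (by-multiple (𝒬-rec 0) (const (+ 1))
  (by-multiple 𝒬₀-geometric (const (+ 1)) (by-multiple (r⋆𝒟 0) (⊖ z)
    (solve 7 (λ z r d₀ d₁ q₀ q₁ q₂ →
        d₀ :+ con (+ 1) :* (z :* d₁ :+ q₁) :+ con (+ 1) :* (q₀ :+ z :* (q₂ :+ q₁))
          :+ con (+ 1) :* (con (+ 1) :+ z :* q₀) :+ (:- z) :* d₁
        := con (+ 1) :+ z :* (r :* d₀) :+ con (+ 1) :* (d₀ :+ z :* (q₁ :+ q₂))
          :+ con (+ 1) :* (q₁ :+ z :* q₀) :+ con (+ 1) :* q₀ :+ (:- z) :* (r :* d₀))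
      𝕊.refl z r (𝒟 0) (𝒟 1) (𝒬 0) (𝒬 1) (𝒬 2)))))

-- The characteristic equation of the recurrence: in `𝒬-rec 0` times `1 - z`, the series
-- `(1 - z) 𝒬 k` for `k` = 0, 1, 2 are 1, `r` and `r ⋆ r`.
r-quadratic : r ⊕ z ≗ const (+ 1) ⊕ (z ⋆ ((r ⋆ r) ⊕ r))
r-quadratic = by-multiple (𝒬-rec 0) (const (+ 1) ⊕ (⊖ z)) (by-multiple 𝒬₀-geometric (const (+ 1) ⊕ (⊖ z))
  (by-multiple (r⋆𝒬 1) (⊖ (z ⋆ (const (+ 1) ⊕ (⊖ z))))
    (solve 4 (λ z q₀ q₁ q₂ → let r = (con (+ 1) :- z) :* q₁ in
        r :+ z :+ (con (+ 1) :- z) :* (q₀ :+ z :* (q₂ :+ q₁))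
          :+ (con (+ 1) :- z) :* (con (+ 1) :+ z :* q₀) :+ (:- (z :* (con (+ 1) :- z))) :* q₂
        := con (+ 1) :+ z :* (r :* r :+ r) :+ (con (+ 1) :- z) :* (q₁ :+ z :* q₀)
          :+ (con (+ 1) :- z) :* q₀ :+ (:- (z :* (con (+ 1) :- z))) :* (r :* q₁))
      𝕊.refl z (𝒬 0) (𝒬 1) (𝒬 2))))

-- In `r-quadratic` times `z (𝒟 0)²`, `r` occurs only through `z r 𝒟 0`, which is `𝒟 0 - 1` by
-- `𝒟₀-linear`.
𝒟₀-quadratic : (((const (+ 2) ⋆ z) ⊕ (⊖ (z ⋆ z))) ⋆ (𝒟 0 ⋆ 𝒟 0)) ⊕ const (+ 1) ≗ (const (+ 1) ⊕ z) ⋆ 𝒟 0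
𝒟₀-quadratic = by-multiple r-quadratic (⊖ (z ⋆ (𝒟 0 ⋆ 𝒟 0)))
  -- What remains is quadratic in `z r 𝒟 0` with root `𝒟 0 - 1`; the multiple is, up to sign, its
  -- quotient by that linear factor.
  (by-multiple 𝒟₀-linear (((z ⋆ 𝒟 0) ⊕ (⊖ const (+ 1))) ⊕ (z ⋆ (r ⋆ 𝒟 0)))
    (solve 3 (λ z r d₀ →
        (con (+ 2) :* z :- z :* z) :* (d₀ :* d₀) :+ con (+ 1)
          :+ (:- (z :* (d₀ :* d₀))) :* (con (+ 1) :+ z :* (r :* r :+ r))
          :+ (z :* d₀ :- con (+ 1) :+ z :* (r :* d₀)) :* (con (+ 1) :+ z :* (r :* d₀))
        := (con (+ 1) :+ z) :* d₀ :+ (:- (z :* (d₀ :* d₀))) :* (r :+ z)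
          :+ (z :* d₀ :- con (+ 1) :+ z :* (r :* d₀)) :* d₀)
      𝕊.refl z r (𝒟 0)))

-- Solving the quadratic equation

poly-∷ : ∀ c cs → poly (c ∷ cs) ≗ const c ⊕ (z ⋆ poly cs)
poly-∷ c cs zero    = sym (ℤ.+-identityʳ c)
poly-∷ c cs (suc n) = sym (trans (ℤ.+-identityˡ _) (z-⋆-suc (poly cs) n))

poly-quadratic : ∀ a b c → poly (a ∷ b ∷ c ∷ []) ≗ const a ⊕ (z ⋆ (const b ⊕ (z ⋆ const c)))
poly-quadratic a b c = 𝕊.trans {j = const a ⊕ (z ⋆ poly (b ∷ c ∷ []))} (poly-∷ a (b ∷ c ∷ []))
  (λ n → cong (λ x → const a n + x) (⋆-cong {f = z} (λ _ → refl) (poly-∷ b (c ∷ [])) n))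

-- Both `1+z - X` and `S` square to the radicand, so `(1+z - X + S) (1+z - X - S) = 0`. The first
-- factor has nonzero constant term and can be cancelled.
denom⋆𝒟₀ : ∀ S → IsSqrtRadicand S → denom ⋆ 𝒟 0 ≗ numer S
denom⋆𝒟₀ S (S₀≡1 , S⋆S≗radicand) = by-multiple conjugate≗0 (⊖ const (+ 1))
  (solve 3 (λ p X S → X :+ (:- con (+ 1)) :* con (+ 0)
       := p :- S :+ (:- con (+ 1)) :* (p :- X :- S))
     𝕊.refl 1+z X S)
  where
  X 1+z : Series
  X = denom ⋆ 𝒟 0
  1+z = poly (+ 1 ∷ + 1 ∷ [])
  conjugate-product : (((1+z ⊕ (⊖ X)) ⊕ S) ⋆ ((1+z ⊕ (⊖ X)) ⊕ (⊖ S))) ≗ const (+ 0)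
  conjugate-product = by-multiple S⋆S≗radicand (⊖ const (+ 1))
    (by-multiple (poly-quadratic (+ 1) (- + 6) (+ 5)) (⊖ const (+ 1))
    -- `1+z` and, in the next multiple, `denom` are replaced by their Horner forms. Each enters
    -- quadratically, so its multiple contains the sum of old and new form, as in a difference of
    -- squares, and a cross term.
    (by-multiple (poly-∷ (+ 1) (+ 1 ∷ [])) ((1+z ⊕ (const (+ 1) ⊕ (z ⋆ const (+ 1)))) ⊕ (⊖ (const (+ 2) ⋆ X)))
    (by-multiple (poly-quadratic (+ 0) (+ 4) (- + 2))
      ((⊖ (const (+ 2) ⋆ ((const (+ 1) ⊕ z) ⋆ 𝒟 0))) ⊕ ((𝒟 0 ⋆ 𝒟 0) ⋆ (denom ⊕ ((const (+ 4) ⋆ z) ⊕ (⊖ (const (+ 2) ⋆ (z ⋆ z)))))))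
    -- Completing the square: the multiple is four times the leading coefficient `2z - z²`, and the
    -- discriminant `(1 + z)² - 4 (2z - z²)` is the radicand.
    (by-multiple 𝒟₀-quadratic ((const (+ 8) ⋆ z) ⊕ (⊖ (const (+ 4) ⋆ (z ⋆ z))))
      (solve 6 (λ z S p e d₀ ρ → let X = e :* d₀ in
          (p :- X :+ S) :* (p :- X :- S)
            :+ (:- con (+ 1)) :* ρ
            :+ (:- con (+ 1)) :* (con (+ 1) :+ z :* (con (- + 6) :+ z :* con (+ 5)))
            :+ (p :+ (con (+ 1) :+ z :* con (+ 1)) :- con (+ 2) :* X) :* (con (+ 1) :+ z :* con (+ 1))
            :+ (:- (con (+ 2) :* ((con (+ 1) :+ z) :* d₀)) :+ d₀ :* d₀ :* (e :+ (con (+ 4) :* z :- con (+ 2) :* (z :* z))))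
               :* (con (+ 0) :+ z :* (con (+ 4) :+ z :* con (- + 2)))
            :+ (con (+ 8) :* z :- con (+ 4) :* (z :* z)) :* ((con (+ 1) :+ z) :* d₀)
          := con (+ 0)
            :+ (:- con (+ 1)) :* (S :* S)
            :+ (:- con (+ 1)) :* ρ
            :+ (p :+ (con (+ 1) :+ z :* con (+ 1)) :- con (+ 2) :* X) :* p
            :+ (:- (con (+ 2) :* ((con (+ 1) :+ z) :* d₀)) :+ d₀ :* d₀ :* (e :+ (con (+ 4) :* z :- con (+ 2) :* (z :* z))))
               :* e
            :+ (con (+ 8) :* z :- con (+ 4) :* (z :* z)) :* ((con (+ 2) :* z :- z :* z) :* (d₀ :* d₀) :+ con (+ 1)))
        𝕊.refl z S 1+z denom (𝒟 0) radicand)))))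
  conjugate≗0 : (1+z ⊕ (⊖ X)) ⊕ (⊖ S) ≗ const (+ 0)
  -- The constant term of the cancelled factor is `1 - 0 + S 0 = 2`.
  conjugate≗0 = f⋆g≗0⇒g≗0 ((1+z ⊕ (⊖ X)) ⊕ S) (λ eq → contradiction (trans (sym eq) (cong (λ x → + 1 + x) S₀≡1)) λ ())
    ((1+z ⊕ (⊖ X)) ⊕ (⊖ S)) conjugate-product

-- The generating tree of the class

private variable
  n k m : ℕ

Word : ℕ → Set
Word n = Vec (Fin n) n

-- The position of `d` relative to `i` and `j` is left open, which merges the three patterns into
-- one condition.
TopsAreRecords : Word n → Set
TopsAreRecords {n} σ = ∀ (i j l d : Fin n) → i <ᶠ j → j <ᶠ l → d <ᶠ l →
  lookup σ i <ᶠ lookup σ j → lookup σ j <ᶠ lookup σ l → ¬ (lookup σ l <ᶠ lookup σ d)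

-- Listing the occurrence by value through `π⁻¹` leaves only increasing chains to check; the
-- converse implication follows by trichotomy.
contains : (σ : Word n) (π π⁻¹ : Word k) → (∀ x → lookup π⁻¹ (lookup π x) ≡ x) →
  (f : Fin k → Fin n) → (∀ x y → x <ᶠ y → f x <ᶠ f y) →
  (∀ x y → x <ᶠ y → lookup σ (f (lookup π⁻¹ x)) <ᶠ lookup σ (f (lookup π⁻¹ y))) →
  Contains σ π
contains σ π π⁻¹ inverse f f-mono σfπ⁻¹-mono = f , f-mono , λ x y → mk⇔ (to x y) (from x y)
  where
  to : ∀ x y → lookup π x <ᶠ lookup π y → lookup σ (f x) <ᶠ lookup σ (f y)
  to x y πx<πy = subst₂ (λ x y → lookup σ (f x) <ᶠ lookup σ (f y)) (inverse x) (inverse y)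
    (σfπ⁻¹-mono (lookup π x) (lookup π y) πx<πy)
  from : ∀ x y → lookup σ (f x) <ᶠ lookup σ (f y) → lookup π x <ᶠ lookup π y
  from x y lt with Fin.<-cmp (lookup π x) (lookup π y)
  ... | tri< πx<πy _ _ = πx<πy
  ... | tri≈ _ πx≡πy _ = contradiction lt (ℕ.<-irrefl (cong (λ x → toℕ (lookup σ (f x)))
                           (trans (sym (inverse x)) (trans (cong (lookup π⁻¹) πx≡πy) (inverse y)))))
  ... | tri> _ _ πy<πx = contradiction lt (ℕ.<-asym (to y x πy<πx))

chain-mono : (g : Fin 4 → Fin n) → g 0F <ᶠ g 1F → g 1F <ᶠ g 2F → g 2F <ᶠ g 3F →
  ∀ x y → x <ᶠ y → g x <ᶠ g y
chain-mono g a b c 0F 1F _ = a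
chain-mono g a b c 0F 2F _ = ℕ.<-trans a b
chain-mono g a b c 0F 3F _ = ℕ.<-trans a (ℕ.<-trans b c)
chain-mono g a b c 1F 2F _ = b
chain-mono g a b c 1F 3F _ = ℕ.<-trans b c
chain-mono g a b c 2F 3F _ = c
chain-mono g a b c (suc x) 1F (s≤s ())
chain-mono g a b c (suc (suc x)) 2F (s≤s (s≤s ()))
chain-mono g a b c 3F 3F (s≤s (s≤s (s≤s ())))

0<1 : _<ᶠ_ {4} {4} 0F 1F
0<1 = s≤s z≤n
1<2 : _<ᶠ_ {4} {4} 1F 2F
1<2 = s≤s (s≤s z≤n)
2<3 : _<ᶠ_ {4} {4} 2F 3F
2<3 = s≤s (s≤s (s≤s z≤n))

-- The larger entry at `d` gives 4123 before `i`, 1423 between `i` and `j`, and 1243 between `j` and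
-- `l`; it cannot coincide with `i` or `j` because of its value.
InClass⇒TopsAreRecords : (σ : Word n) → InClass σ → TopsAreRecords σ
InClass⇒TopsAreRecords {n} σ (_ , ¬4123 , ¬1243 , ¬1423) i j l d i<j j<l d<l σi<σj σj<σl σl<σd
  with Fin.<-cmp d i | Fin.<-cmp d j
... | tri< d<i _ _ | _ = ¬4123 (contains σ p4123 π⁻¹ inverse f (chain-mono f d<i i<j j<l)
                          (chain-mono (lookup σ ∘ f ∘ lookup π⁻¹) σi<σj σj<σl σl<σd))
  where
  π⁻¹ : Word 4
  π⁻¹ = 1F Vec.∷ 2F Vec.∷ 3F Vec.∷ 0F Vec.∷ Vec.[]
  inverse : ∀ x → lookup π⁻¹ (lookup p4123 x) ≡ x
  inverse = λ { 0F → refl ; 1F → refl ; 2F → refl ; 3F → refl }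
  f : Fin 4 → Fin n
  f = lookup (d Vec.∷ i Vec.∷ j Vec.∷ l Vec.∷ Vec.[])
... | tri≈ _ refl _ | _ = ℕ.<-asym (ℕ.<-trans σi<σj σj<σl) σl<σd
... | tri> _ _ i<d | tri< d<j _ _ = ¬1423 (contains σ p1423 π⁻¹ inverse f (chain-mono f i<d d<j j<l)
                          (chain-mono (lookup σ ∘ f ∘ lookup π⁻¹) σi<σj σj<σl σl<σd))
  where
  π⁻¹ : Word 4
  π⁻¹ = 0F Vec.∷ 2F Vec.∷ 3F Vec.∷ 1F Vec.∷ Vec.[]
  inverse : ∀ x → lookup π⁻¹ (lookup p1423 x) ≡ x
  inverse = λ { 0F → refl ; 1F → refl ; 2F → refl ; 3F → refl }
  f : Fin 4 → Fin n
  f = lookup (i Vec.∷ d Vec.∷ j Vec.∷ l Vec.∷ Vec.[])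
... | tri> _ _ _ | tri≈ _ refl _ = ℕ.<-asym σj<σl σl<σd
... | tri> _ _ _ | tri> _ _ j<d = ¬1243 (contains σ p1243 π⁻¹ inverse f (chain-mono f i<j j<d d<l)
                          (chain-mono (lookup σ ∘ f ∘ lookup π⁻¹) σi<σj σj<σl σl<σd))
  where
  π⁻¹ : Word 4
  π⁻¹ = 0F Vec.∷ 1F Vec.∷ 3F Vec.∷ 2F Vec.∷ Vec.[]
  inverse : ∀ x → lookup π⁻¹ (lookup p1243 x) ≡ x
  inverse = λ { 0F → refl ; 1F → refl ; 2F → refl ; 3F → refl }
  f : Fin 4 → Fin n
  f = lookup (i Vec.∷ j Vec.∷ d Vec.∷ l Vec.∷ Vec.[])

TopsAreRecords⇒InClass : (σ : Word n) → IsPerm σ → TopsAreRecords σ → InClass σ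
TopsAreRecords⇒InClass σ perm tops = perm
  , (λ (f , mono , iff) → tops (f 1F) (f 2F) (f 3F) (f 0F)
      (mono 1F 2F 1<2) (mono 2F 3F 2<3) (mono 0F 3F (s≤s z≤n))
      (Equivalence.to (iff 1F 2F) 0<1) (Equivalence.to (iff 2F 3F) 1<2) (Equivalence.to (iff 3F 0F) 2<3))
  , (λ (f , mono , iff) → tops (f 0F) (f 1F) (f 3F) (f 2F)
      (mono 0F 1F 0<1) (mono 1F 3F (s≤s (s≤s z≤n))) (mono 2F 3F 2<3)
      (Equivalence.to (iff 0F 1F) 0<1) (Equivalence.to (iff 1F 3F) 1<2) (Equivalence.to (iff 3F 2F) 2<3))
  , (λ (f , mono , iff) → tops (f 0F) (f 2F) (f 3F) (f 1F)
      (mono 0F 2F (s≤s z≤n)) (mono 2F 3F 2<3) (mono 1F 3F (s≤s (s≤s z≤n)))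
      (Equivalence.to (iff 0F 2F) 0<1) (Equivalence.to (iff 2F 3F) 1<2) (Equivalence.to (iff 3F 1F) 2<3))

-- Appending a last value

punchIn-below : (c : Fin (suc n)) (x : Fin n) → toℕ x ℕ.< toℕ c → toℕ (punchIn c x) ≡ toℕ x
punchIn-below (suc c) zero    _         = refl
punchIn-below (suc c) (suc x) (s≤s x<c) = cong suc (punchIn-below c x x<c)

punchIn-inflationary : (c : Fin (suc n)) (x : Fin n) → toℕ x ℕ.≤ toℕ (punchIn c x)
punchIn-inflationary zero    x       = ℕ.n≤1+n (toℕ x)
punchIn-inflationary (suc c) zero    = z≤n
punchIn-inflationary (suc c) (suc x) = s≤s (punchIn-inflationary c x)

punchIn-above : (c : Fin (suc n)) (x : Fin n) → toℕ c ℕ.≤ toℕ x → toℕ c ℕ.< toℕ (punchIn c x)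
punchIn-above zero    x       _         = s≤s z≤n
punchIn-above (suc c) (suc x) (s≤s c≤x) = s≤s (punchIn-above c x c≤x)

punchIn<⇒< : (c : Fin (suc n)) (x : Fin n) → toℕ (punchIn c x) ℕ.< toℕ c → toℕ x ℕ.< toℕ c
punchIn<⇒< c x = ℕ.≤-<-trans (punchIn-inflationary c x)

punchIn-mono-< : (c : Fin (suc n)) (x y : Fin n) → x <ᶠ y → punchIn c x <ᶠ punchIn c y
punchIn-mono-< c x y x<y = ℕ.≰⇒> (ℕ.<⇒≱ x<y ∘ Fin.punchIn-cancel-≤ c y x)

punchIn-cancel-< : (c : Fin (suc n)) (x y : Fin n) → punchIn c x <ᶠ punchIn c y → x <ᶠ y
punchIn-cancel-< c x y lt = ℕ.≰⇒> (ℕ.<⇒≱ lt ∘ Fin.punchIn-mono-≤ c y x)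

inject₁-mono-< : (i j : Fin n) → i <ᶠ j → inject₁ i <ᶠ inject₁ j
inject₁-mono-< i j = subst₂ ℕ._<_ (sym (Fin.toℕ-inject₁ i)) (sym (Fin.toℕ-inject₁ j))

inject₁-cancel-< : (i j : Fin n) → inject₁ i <ᶠ inject₁ j → i <ᶠ j
inject₁-cancel-< i j = subst₂ ℕ._<_ (Fin.toℕ-inject₁ i) (Fin.toℕ-inject₁ j)

inject₁<fromℕ : (i : Fin n) → inject₁ i <ᶠ fromℕ n
inject₁<fromℕ {n} i = subst (toℕ (inject₁ i) ℕ.<_) (sym (Fin.toℕ-fromℕ n)) (Fin.inject₁ℕ< i)

<⇒inject₁ : (i j : Fin (suc n)) → i <ᶠ j → ∃ λ i′ → i ≡ inject₁ i′
<⇒inject₁ i j i<j with view i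
... | ‵fromℕ      = contradiction i<j (ℕ.≤⇒≯ (Fin.≤fromℕ j))
... | ‵inject₁ i′ = i′ , refl

append : Word n → Fin (suc n) → Word (suc n)
append σ c = Vec.map (punchIn c) σ Vec.∷ʳ c

lookup-∷ʳ-inject₁ : ∀ {A : Set} (xs : Vec A n) x i → lookup (xs Vec.∷ʳ x) (inject₁ i) ≡ lookup xs i
lookup-∷ʳ-inject₁ (y Vec.∷ xs) x zero    = refl
lookup-∷ʳ-inject₁ (y Vec.∷ xs) x (suc i) = lookup-∷ʳ-inject₁ xs x i

lookup-∷ʳ-fromℕ : ∀ {A : Set} (xs : Vec A n) x → lookup (xs Vec.∷ʳ x) (fromℕ n) ≡ x
lookup-∷ʳ-fromℕ Vec.[]       x = refl
lookup-∷ʳ-fromℕ (y Vec.∷ xs) x = lookup-∷ʳ-fromℕ xs x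

append-old : (σ : Word n) (c : Fin (suc n)) (i : Fin n) →
  lookup (append σ c) (inject₁ i) ≡ punchIn c (lookup σ i)
append-old σ c i = trans (lookup-∷ʳ-inject₁ (Vec.map (punchIn c) σ) c i) (Vec.lookup-map i (punchIn c) σ)

append-new : (σ : Word n) (c : Fin (suc n)) → lookup (append σ c) (fromℕ n) ≡ c
append-new σ c = lookup-∷ʳ-fromℕ (Vec.map (punchIn c) σ) c

append-old-mono-< : (σ : Word n) (c : Fin (suc n)) (i j : Fin n) → lookup σ i <ᶠ lookup σ j →
  lookup (append σ c) (inject₁ i) <ᶠ lookup (append σ c) (inject₁ j)
append-old-mono-< σ c i j lt rewrite append-old σ c i | append-old σ c j = punchIn-mono-< c _ _ lt

append-old-cancel-< : (σ : Word n) (c : Fin (suc n)) (i j : Fin n) →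
  lookup (append σ c) (inject₁ i) <ᶠ lookup (append σ c) (inject₁ j) → lookup σ i <ᶠ lookup σ j
append-old-cancel-< σ c i j lt rewrite append-old σ c i | append-old σ c j = punchIn-cancel-< c _ _ lt

lookup-ext : ∀ {A : Set} (xs ys : Vec A n) → lookup xs ≗ lookup ys → xs ≡ ys
lookup-ext xs ys eq = trans (sym (Vec.tabulate∘lookup xs)) (trans (Vec.tabulate-cong eq) (Vec.tabulate∘lookup ys))

append-injective : (σ τ : Word n) (c d : Fin (suc n)) → append σ c ≡ append τ d → σ ≡ τ × c ≡ d
append-injective {n} σ τ c d eq with trans (sym (append-new σ c)) (trans (cong (λ ρ → lookup ρ (fromℕ n)) eq) (append-new τ d))
... | refl = lookup-ext σ τ (λ i → Fin.punchIn-injective c _ _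
               (trans (sym (append-old σ c i)) (trans (cong (λ ρ → lookup ρ (inject₁ i)) eq) (append-old τ c i)))) , refl

IsPerm-append : (σ : Word n) (c : Fin (suc n)) → IsPerm σ → IsPerm (append σ c)
IsPerm-append σ c perm i j eq with view i | view j
... | ‵fromℕ     | ‵fromℕ     = refl
... | ‵fromℕ     | ‵inject₁ j = contradiction
  (trans (sym (append-old σ c j)) (trans (sym eq) (append-new σ c))) (Fin.punchInᵢ≢i c _)
... | ‵inject₁ i | ‵fromℕ     = contradiction
  (trans (sym (append-old σ c i)) (trans eq (append-new σ c))) (Fin.punchInᵢ≢i c _)
... | ‵inject₁ i | ‵inject₁ j = cong inject₁ (perm i j (Fin.punchIn-injective c _ _
  (trans (sym (append-old σ c i)) (trans eq (append-old σ c j)))))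

IsPerm-append⁻ : (σ : Word n) (c : Fin (suc n)) → IsPerm (append σ c) → IsPerm σ
IsPerm-append⁻ σ c perm i j eq = Fin.inject₁-injective (perm (inject₁ i) (inject₁ j)
  (trans (append-old σ c i) (trans (cong (punchIn c) eq) (sym (append-old σ c j)))))

IsPerm⇒append : (σ : Word (suc n)) → IsPerm σ → ∃ λ τ → ∃ λ c → σ ≡ append τ c
IsPerm⇒append {n} σ perm = τ , c , lookup-ext σ (append τ c) σ≗append
  where
  c : Fin (suc n)
  c = lookup σ (fromℕ n)
  c≢σ : ∀ i → c ≢ lookup σ (inject₁ i)
  c≢σ i eq = Fin.fromℕ≢inject₁ (perm (fromℕ n) (inject₁ i) eq)
  τ : Word n
  τ = Vec.tabulate (λ i → punchOut (c≢σ i))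
  σ≗append : lookup σ ≗ lookup (append τ c)
  σ≗append i with view i
  ... | ‵fromℕ     = sym (append-new τ c)
  ... | ‵inject₁ i = sym (trans (append-old τ c i) (trans
    (cong (punchIn c) (Vec.lookup∘tabulate _ i)) (Fin.punchIn-punchOut (c≢σ i))))

-- Carried along the tree to locate prescribed values: the maximum, and the value just below an
-- appended one.
Surjective : Word n → Set
Surjective {n} σ = ∀ v → ∃ λ i → lookup σ i ≡ v

Surjective-append : (σ : Word n) (c : Fin (suc n)) → Surjective σ → Surjective (append σ c)
Surjective-append {n} σ c surj v with c Fin.≟ v
... | yes refl = fromℕ n , append-new σ c
... | no c≢v with surj (punchOut c≢v)
...   | i , eq = inject₁ i , trans (append-old σ c i) (trans (cong (punchIn c) eq) (Fin.punchIn-punchOut c≢v))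

-- Expressed through ascents: the values below `k` occur in decreasing order iff no ascent has its
-- top below `k`.
DecreasingBelow : ℕ → Word n → Set
DecreasingBelow {n} k σ = ∀ (i j : Fin n) → i <ᶠ j → lookup σ i <ᶠ lookup σ j → k ℕ.≤ toℕ (lookup σ j)

-- Witnesses that a bound `k` in `DecreasingBelow k` is the largest possible.
AscentTo : ℕ → Word n → Set
AscentTo {n} k σ = ∃ λ (i : Fin n) → ∃ λ (j : Fin n) → i <ᶠ j × lookup σ i <ᶠ lookup σ j × toℕ (lookup σ j) ≡ k

DecreasingBelow-append : (σ : Word n) (c : Fin (suc n)) →
  (∀ i j → i <ᶠ j → lookup σ i <ᶠ lookup σ j → k ℕ.≤ toℕ (punchIn c (lookup σ j))) →
  (∀ i → toℕ (lookup σ i) ℕ.< toℕ c → k ℕ.≤ toℕ c) → DecreasingBelow k (append σ c)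
DecreasingBelow-append σ c old new i j i<j lt with <⇒inject₁ i j i<j | view j
... | i , refl | ‵fromℕ rewrite append-new σ c | append-old σ c i = new i (punchIn<⇒< c (lookup σ i) lt)
... | i , refl | ‵inject₁ j with append-old-cancel-< σ c i j lt
...   | lt′ rewrite append-old σ c j = old i j (inject₁-cancel-< i j i<j) lt′

AscentTo-append : (σ : Word n) (c : Fin (suc n)) → ((i , j , _) : AscentTo k σ) →
  toℕ (punchIn c (lookup σ j)) ≡ m → AscentTo m (append σ c)
AscentTo-append σ c (i , j , i<j , lt , _) eq = inject₁ i , inject₁ j , inject₁-mono-< i j i<j ,
  append-old-mono-< σ c i j lt , trans (cong toℕ (append-old σ c j)) eq

Allowed : Word n → Fin (suc n) → Set
Allowed {n} σ c = toℕ c ≡ n ⊎ DecreasingBelow (toℕ c) σ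

-- A violation ending at an old entry already occurs in `σ`. One ending at the new entry needs a
-- larger value, excluded for a new maximum, and an ascent below `c`, excluded if the values below
-- `c` decrease.
TopsAreRecords-append : (σ : Word n) (c : Fin (suc n)) → TopsAreRecords σ → Allowed σ c →
  TopsAreRecords (append σ c)
TopsAreRecords-append {n} σ c tops allowed i j l d i<j j<l d<l ij jl ld
  with <⇒inject₁ i j i<j | <⇒inject₁ j l j<l | <⇒inject₁ d l d<l | view l
... | i , refl | j , refl | d , refl | ‵inject₁ l = tops i j l d
  (inject₁-cancel-< i j i<j) (inject₁-cancel-< j l j<l) (inject₁-cancel-< d l d<l)
  (append-old-cancel-< σ c i j ij) (append-old-cancel-< σ c j l jl) (append-old-cancel-< σ c l d ld)
... | i , refl | j , refl | d , refl | ‵fromℕ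
  with append-old-cancel-< σ c i j ij
...   | lt rewrite append-new σ c | append-old σ c j | append-old σ c d with allowed
...     | inj₁ c≡n = ℕ.<⇒≱ ld (ℕ.≤-trans (Fin.toℕ≤pred[n] (punchIn c (lookup σ d))) (ℕ.≤-reflexive (sym c≡n)))
...     | inj₂ dec = ℕ.<⇒≱ (punchIn<⇒< c (lookup σ j) jl) (dec i j (inject₁-cancel-< i j i<j) lt)

TopsAreRecords-append⁻ : (σ : Word n) (c : Fin (suc n)) → TopsAreRecords (append σ c) → TopsAreRecords σ
TopsAreRecords-append⁻ σ c tops i j l d i<j j<l d<l ij jl ld = tops (inject₁ i) (inject₁ j) (inject₁ l) (inject₁ d)
  (inject₁-mono-< i j i<j) (inject₁-mono-< j l j<l) (inject₁-mono-< d l d<l)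
  (append-old-mono-< σ c i j ij) (append-old-mono-< σ c j l jl) (append-old-mono-< σ c l d ld)

-- An ascent with top below `c` would form a 123 with the new entry, while the old maximum is raised
-- above `c` because `c` is not the new maximum.
TopsAreRecords-append⇒≤ : (σ : Word n) (c : Fin (suc n)) → Surjective σ → TopsAreRecords (append σ c) →
  AscentTo k σ → toℕ c ℕ.< n → toℕ c ℕ.≤ k
TopsAreRecords-append⇒≤ {n = suc n} σ c surj tops (i , j , i<j , lt , refl) c<1+n = ℕ.≮⇒≥ λ σj<c →
  tops (inject₁ i) (inject₁ j) (fromℕ _) (inject₁ d)
    (inject₁-mono-< i j i<j) (inject₁<fromℕ j) (inject₁<fromℕ d) (append-old-mono-< σ c i j lt)
    (subst₂ _<ᶠ_ (sym (append-old σ c j)) (sym (append-new σ c))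
      (subst (ℕ._< toℕ c) (sym (punchIn-below c (lookup σ j) σj<c)) σj<c))
    (subst₂ _<ᶠ_ (sym (append-new σ c)) (sym (append-old σ c d))
      (punchIn-above c (lookup σ d) (subst (toℕ c ℕ.≤_) (sym (trans (cong toℕ (proj₂ (surj (fromℕ n)))) (Fin.toℕ-fromℕ n)))
        (ℕ.≤-pred c<1+n))))
  where
  d : Fin (suc n)
  d = proj₁ (surj (fromℕ n))

-- Labelled nodes and their children

data Label : Set where
  decr : Label
  non  : ℕ → Label

-- All values are below `n`, so the condition for `decr` excludes every ascent.
Labelled : Label → Word n → Set
Labelled {n} decr    σ = DecreasingBelow n σ
Labelled     (non k) σ = DecreasingBelow k σ × AscentTo k σ

record Node (n : ℕ) : Set where
  constructor node
  field
    word       : Word n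
    isPerm     : IsPerm word
    surjective : Surjective word
    tops       : TopsAreRecords word
    label      : Label
    labelled   : Labelled label word
open Node

appendNode : (ν : Node n) (c : Fin (suc n)) → Allowed (word ν) c → (l : Label) → Labelled l (append (word ν) c) → Node (suc n)
appendNode (node σ perm surj tops _ _) c allowed l inv = node (append σ c)
  (IsPerm-append σ c perm) (Surjective-append σ c surj) (TopsAreRecords-append σ c tops allowed) l inv

-- The values 1 to `k`. The value 0 is treated apart, as it ends no ascent and shifts the old label.
lowValue : .(k ℕ.≤ n) → Fin k → Fin (suc n)
lowValue k≤n j = suc (inject≤ j k≤n)

-- The value `c - 1` keeps its size and precedes the new entry `c`, so `c` tops an ascent and
-- becomes the label. It is recorded as `suc (toℕ j)`, the form in which the weights are summed.
lowChild : (ν : Node n) .(k≤n : k ℕ.≤ n) → DecreasingBelow k (word ν) → Fin k → Node (suc n)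
lowChild {n} {k} ν k≤n dec j = appendNode ν c (inj₂ dec-c) (non (suc (toℕ j)))
    (subst (λ m → Labelled (non m) (append σ c)) c≡
      ( DecreasingBelow-append σ c (λ i j i<j lt → ℕ.≤-trans (dec-c i j i<j lt) (punchIn-inflationary c (lookup σ j)))
                                  (λ _ _ → ℕ.≤-refl)
      , inject₁ i₀ , fromℕ _ , inject₁<fromℕ i₀
      , subst₂ _<ᶠ_ (sym (trans (append-old σ c i₀) (cong (punchIn c) (proj₂ (surjective ν v))))) (sym (append-new σ c))
          (s≤s (ℕ.≤-reflexive (punchIn-below c v ℕ.≤-refl)))
      , cong toℕ (append-new σ c)))
  where
  σ : Word n
  σ = word ν
  v : Fin n
  v = inject≤ j k≤n
  c : Fin (suc n)
  c = suc v
  c≡ : toℕ c ≡ suc (toℕ j)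
  c≡ = cong suc (Fin.toℕ-inject≤ j k≤n)
  dec-c : DecreasingBelow (toℕ c) σ
  dec-c i j′ i<j′ lt = ℕ.≤-trans (ℕ.≤-trans (ℕ.≤-reflexive c≡) (Fin.toℕ<n j)) (dec i j′ i<j′ lt)
  i₀ : Fin n
  i₀ = proj₁ (surjective ν v)

zeroChild : (ν : Node n) (l : Label) → Labelled l (append (word ν) zero) → Node (suc n)
zeroChild ν = appendNode ν zero (inj₂ λ _ _ _ _ → z≤n)

DecreasingBelow-append-zero : (σ : Word n) → DecreasingBelow k σ → DecreasingBelow (suc k) (append σ zero)
DecreasingBelow-append-zero σ dec = DecreasingBelow-append σ zero (λ i j i<j lt → s≤s (dec i j i<j lt)) (λ _ ())

AscentTo⇒< : (σ : Word n) → AscentTo k σ → k ℕ.< n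
AscentTo⇒< σ (_ , j , _ , _ , refl) = Fin.toℕ<n (lookup σ j)

-- A new maximum only adds ascents with top `n`, and `k < n`, so the label stays.
maxChild : (ν : Node n) → DecreasingBelow k (word ν) → AscentTo k (word ν) → Node (suc n)
maxChild {n} {k} ν dec asc = appendNode ν (fromℕ n) (inj₁ (Fin.toℕ-fromℕ n)) (non k)
  ( DecreasingBelow-append σ (fromℕ n)
      (λ i j i<j lt → ℕ.≤-trans (dec i j i<j lt) (punchIn-inflationary (fromℕ n) (lookup σ j)))
      (λ _ _ → ℕ.≤-trans (ℕ.<⇒≤ (AscentTo⇒< σ asc)) (ℕ.≤-reflexive (sym (Fin.toℕ-fromℕ n))))
  , AscentTo-append σ (fromℕ n) asc (trans
      (punchIn-below (fromℕ n) (lookup σ j) (subst (toℕ (lookup σ j) ℕ.<_) (sym (Fin.toℕ-fromℕ n)) (Fin.toℕ<n (lookup σ j))))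
      (proj₂ (proj₂ (proj₂ (proj₂ asc))))))
  where
  σ : Word n
  σ = word ν
  j : Fin n
  j = proj₁ (proj₂ asc)

-- For `decr` the low values 1 to `n` include the new maximum; for `non k` they stop at `k < n`, so
-- the maximum is added separately.
children : Node n → List (Node (suc n))
children {n} ν@(node σ _ _ _ decr dec) =
  zeroChild ν decr (DecreasingBelow-append-zero σ dec) ∷ tabulate (lowChild ν ℕ.≤-refl dec)
children {n} ν@(node σ _ _ _ (non k) (dec , asc)) =
  maxChild ν dec asc
  ∷ zeroChild ν (non (suc k)) (DecreasingBelow-append-zero σ dec , AscentTo-append σ zero asc (cong suc (proj₂ (proj₂ (proj₂ (proj₂ asc))))))
  ∷ tabulate (lowChild ν (ℕ.<⇒≤ (AscentTo⇒< σ asc)) dec)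

-- Listed in the order of `children`, so that uniqueness and completeness can be settled on the
-- appended values alone.
lastValues : Node n → List (Fin (suc n))
lastValues {n} (node σ _ _ _ decr _)            = zero ∷ tabulate (lowValue (ℕ.≤-refl {n}))
lastValues {n} (node σ _ _ _ (non k) (_ , asc)) = fromℕ n ∷ zero ∷ tabulate (lowValue (ℕ.<⇒≤ (AscentTo⇒< σ asc)))

words-lowChildren : (ν : Node n) .(k≤n : k ℕ.≤ n) (dec : DecreasingBelow k (word ν)) →
  map word (tabulate (lowChild ν k≤n dec)) ≡ map (append (word ν)) (tabulate (lowValue k≤n))
words-lowChildren ν k≤n dec = trans (Listₚ.map-tabulate (lowChild ν k≤n dec) word)
  (sym (Listₚ.map-tabulate (lowValue k≤n) (append (word ν))))

words-children : (ν : Node n) → map word (children ν) ≡ map (append (word ν)) (lastValues ν)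
words-children ν@(node σ _ _ _ decr dec) = cong (_ ∷_) (words-lowChildren ν ℕ.≤-refl dec)
words-children ν@(node σ _ _ _ (non k) (dec , asc)) =
  cong (λ l → _ ∷ _ ∷ l) (words-lowChildren ν (ℕ.<⇒≤ (AscentTo⇒< σ asc)) dec)

zero∷lowValues-unique : .(k≤n : k ℕ.≤ n) → Unique (zero ∷ tabulate (lowValue k≤n))
zero∷lowValues-unique k≤n = All.tabulate⁺ (λ _ ())
  ∷ Unique.tabulate⁺ (λ eq → Fin.inject≤-injective k≤n k≤n _ _ (Fin.suc-injective eq))

lastValues-unique : (ν : Node n) → Unique (lastValues ν)
lastValues-unique (node σ _ _ _ decr _) = zero∷lowValues-unique ℕ.≤-refl
lastValues-unique {n} (node σ _ _ _ (non k) (_ , asc)) = max∉ ∷ zero∷lowValues-unique (ℕ.<⇒≤ k<n)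
  where
  k<n : k ℕ.< n
  k<n = AscentTo⇒< σ asc
  max≢ : (c : Fin (suc n)) → toℕ c ℕ.≤ k → fromℕ n ≢ c
  max≢ c c≤k refl = ℕ.<⇒≱ k<n (ℕ.≤-trans (ℕ.≤-reflexive (sym (Fin.toℕ-fromℕ n))) c≤k)
  max∉ : All (fromℕ n ≢_) (zero ∷ tabulate (lowValue (ℕ.<⇒≤ k<n)))
  max∉ = max≢ zero z≤n All.∷ All.tabulate⁺ (λ j → max≢ (lowValue (ℕ.<⇒≤ k<n) j)
    (subst (ℕ._< k) (sym (Fin.toℕ-inject≤ j _)) (Fin.toℕ<n j)))

≤⇒∈zero∷lowValues : .(k≤n : k ℕ.≤ n) (c : Fin (suc n)) → toℕ c ℕ.≤ k → c ∈ zero ∷ tabulate (lowValue k≤n)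
≤⇒∈zero∷lowValues k≤n zero    _   = here refl
≤⇒∈zero∷lowValues k≤n (suc c) c<k = there (subst (_∈ tabulate (lowValue k≤n))
  (cong suc (Fin.toℕ-injective (trans (Fin.toℕ-inject≤ (fromℕ< c<k) k≤n) (Fin.toℕ-fromℕ< c<k))))
  (∈-tabulate⁺ (fromℕ< c<k)))

lastValues-complete : (ν : Node n) (c : Fin (suc n)) → TopsAreRecords (append (word ν) c) → c ∈ lastValues ν
lastValues-complete (node σ _ _ _ decr _) c _ = ≤⇒∈zero∷lowValues ℕ.≤-refl c (Fin.toℕ≤pred[n] c)
lastValues-complete {n} (node σ _ surj _ (non k) (_ , asc)) c tops with toℕ c ℕ.<? n
... | yes c<n = there (≤⇒∈zero∷lowValues _ c (TopsAreRecords-append⇒≤ σ c surj tops asc c<n))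
... | no  c≮n = here (Fin.toℕ-injective (trans
  (ℕ.≤-antisym (Fin.toℕ≤pred[n] c) (ℕ.≮⇒≥ c≮n)) (sym (Fin.toℕ-fromℕ n))))

-- The tree lists the class without repetition

nodes : ∀ n → List (Node n)
nodes zero    = node Vec.[] (λ ()) (λ ()) (λ ()) decr (λ ()) ∷ []
nodes (suc n) = concatMap children (nodes n)

words-nodes : ∀ n → map word (nodes (suc n)) ≡ concatMap (λ ν → map (append (word ν)) (lastValues ν)) (nodes n)
words-nodes n = trans (Listₚ.map-concatMap word children (nodes n)) (Listₚ.concatMap-cong words-children (nodes n))

-- Siblings differ in their last value and other words in their parents; `append-injective` recovers
-- both.
words-unique : ∀ n → Unique (map word (nodes n))
words-unique zero    = All.[] ∷ []
words-unique (suc n) = subst Unique (sym (words-nodes n)) (Unique.concat⁺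
  (All.map⁺ (All.universal (λ ν → Unique.map⁺ (λ eq → proj₂ (append-injective (word ν) (word ν) _ _ eq)) (lastValues-unique ν)) (nodes n)))
  (AllPairs.map⁺ (AllPairs.map (λ {ν} {μ} → disjoint ν μ) (AllPairs.map⁻ (words-unique n)))))
  where
  disjoint : ∀ (ν μ : Node n) → word ν ≢ word μ → ∀ {σ} →
    ¬ (σ ∈ map (append (word ν)) (lastValues ν) × σ ∈ map (append (word μ)) (lastValues μ))
  disjoint ν μ ν≢μ (∈ν , ∈μ) with ∈-map⁻ _ ∈ν | ∈-map⁻ _ ∈μ
  ... | c , _ , eq | d , _ , eq′ = ν≢μ (proj₁ (append-injective (word ν) (word μ) c d (trans (sym eq) eq′)))

words-complete : ∀ n (σ : Word n) → IsPerm σ → TopsAreRecords σ → σ ∈ map word (nodes n)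
words-complete zero    Vec.[] _    _    = here refl
words-complete (suc n) σ      perm tops with IsPerm⇒append σ perm
... | τ , c , refl with ∈-map⁻ word (words-complete n τ (IsPerm-append⁻ τ c perm) (TopsAreRecords-append⁻ τ c tops))
...   | ν , ν∈ , refl = subst (append τ c ∈_) (sym (words-nodes n))
  (∈-concatMap⁺ _ (lose ν∈ (∈-map⁺ (append τ) (lastValues-complete ν c tops))))

words⇔InClass : ∀ n σ → (σ ∈ map word (nodes n)) ⇔ InClass σ
words⇔InClass n σ = mk⇔ to (λ inClass → words-complete n σ (proj₁ inClass) (InClass⇒TopsAreRecords σ inClass))
  where
  to : σ ∈ map word (nodes n) → InClass σ
  to σ∈ with ∈-map⁻ word σ∈
  ... | ν , _ , refl = TopsAreRecords⇒InClass (word ν) (isPerm ν) (tops ν)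

-- Counting the nodes

HasCard-unique : ∀ {P : Word n → Set} {a b} → HasCard n P a → HasCard n P b → a ≡ b
-- Duplicate-free lists with the same members are rearrangements of each other.
HasCard-unique (xs , xs! , xs⇔ , refl) (ys , ys! , ys⇔ , refl) = ↭-length (∼bag⇒↭ (unique∧set⇒bag xs! ys!
  λ {σ} → mk⇔ (Equivalence.from (ys⇔ σ) ∘ Equivalence.to (xs⇔ σ)) (Equivalence.from (xs⇔ σ) ∘ Equivalence.to (ys⇔ σ))))

weight : ℕ → Node n → ℕ
weight {n} m ν with label ν
... | decr  = D m n
... | non k = T m k

sum-map-concatMap : ∀ {A B : Set} (f : B → ℕ) (g : A → List B) xs →
  sum (map f (concatMap g xs)) ≡ sum (map (λ x → sum (map f (g x))) xs)
sum-map-concatMap f g []       = refl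
sum-map-concatMap f g (x ∷ xs) = trans (cong sum (Listₚ.map-++ f (g x) (concatMap g xs)))
  (trans (sum-++ (map f (g x)) _) (cong (sum (map f (g x)) ℕ.+_) (sum-map-concatMap f g xs)))

tabulate-toℕ : ∀ {A : Set} (f : ℕ → A) k → tabulate {n = k} (f ∘ toℕ) ≡ applyUpTo f k
tabulate-toℕ f zero    = refl
tabulate-toℕ f (suc k) = cong (f 0 ∷_) (tabulate-toℕ (f ∘ suc) k)

weight-lowChildren : ∀ m (ν : Node n) .(k≤n : k ℕ.≤ n) (dec : DecreasingBelow k (word ν)) →
  map (weight m) (tabulate (lowChild ν k≤n dec)) ≡ applyUpTo (λ j → T m (suc j)) k
weight-lowChildren {k = k} m ν k≤n dec = trans (Listₚ.map-tabulate (lowChild ν k≤n dec) (weight m))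
  (tabulate-toℕ (λ j → T m (suc j)) k)

-- The recurrences of `T` and `D` have their summands in the order of `children`, so only the low
-- children need rewriting.
weight-children : ∀ m (ν : Node n) → sum (map (weight m) (children ν)) ≡ weight (suc m) ν
weight-children {n} m ν@(node σ _ _ _ decr dec) =
  cong (λ l → D m (suc n) ℕ.+ sum l) (weight-lowChildren m ν ℕ.≤-refl dec)
weight-children m ν@(node σ _ _ _ (non k) (dec , asc)) =
  cong (λ l → T m k ℕ.+ (T m (suc k) ℕ.+ sum l)) (weight-lowChildren m ν _ dec)

-- Each further generation `n` uses up one unit of the depth `m`, so the total depends only on
-- `n + m` and can be read off at the root.
weight-nodes : ∀ n m → sum (map (weight m) (nodes n)) ≡ D (n ℕ.+ m) 0
weight-nodes zero    m = ℕ.+-identityʳ (D m 0)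
weight-nodes (suc n) m = begin
  sum (map (weight m) (concatMap children (nodes n)))                 ≡⟨ sum-map-concatMap (weight m) children (nodes n) ⟩
  sum (map (λ ν → sum (map (weight m) (children ν))) (nodes n))       ≡⟨ cong sum (Listₚ.map-cong (weight-children m) (nodes n)) ⟩
  sum (map (weight (suc m)) (nodes n))                                ≡⟨ weight-nodes n (suc m) ⟩
  D (n ℕ.+ suc m) 0                                                   ≡⟨ cong (λ m → D m 0) (ℕ.+-suc n m) ⟩
  D (suc n ℕ.+ m) 0                                                   ∎

length≡weight : (νs : List (Node n)) → length νs ≡ sum (map (weight 0) νs)
length≡weight []       = refl
length≡weight (ν ∷ νs) = cong₂ ℕ._+_ (1≡weight ν) (length≡weight νs)
  where
  1≡weight : (ν : Node n) → 1 ≡ weight 0 ν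
  1≡weight ν with label ν
  ... | decr  = refl
  ... | non k = refl

HasCard-InClass : ∀ n → HasCard n InClass (D n 0)
HasCard-InClass n = map word (nodes n) , words-unique n , words⇔InClass n , (begin
  length (map word (nodes n))           ≡⟨ Listₚ.length-map word (nodes n) ⟩
  length (nodes n)                      ≡⟨ length≡weight (nodes n) ⟩
  sum (map (weight 0) (nodes n))        ≡⟨ weight-nodes n 0 ⟩
  D (n ℕ.+ 0) 0                         ≡⟨ cong (λ m → D m 0) (ℕ.+-identityʳ n) ⟩
  D n 0                                 ∎)

theorem3p1 : (J : ℕ → ℕ) → (∀ n → HasCard n InClass (J n)) →
    (S : Series) → IsSqrtRadicand S →
    ∀ n → (denom ⋆ toSeries J) n ≡ numer S n
theorem3p1 J J-counts S S-sqrt n = trans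
  (⋆-cong {f = denom} (λ _ → refl) (λ m → cong +_ (HasCard-unique (J-counts m) (HasCard-InClass m))) n)
  (denom⋆𝒟₀ S S-sqrt n)
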